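{- For every $\eta>0$ and every sufficiently large integer constant $c$ (depending on $\eta$) there is a constant $C$ such that for every $k\ge 2$ the following holds. If $k$ stations execute the protocol NonAdaptiveWithK$(k,c)$ and are activated by any adaptive adversary, then with probability at least $1-1/k^{\eta}$ the total number of broadcast attempts (transmissions, successful or not, by all stations together) during the execution is at most $C k\log k$.
   Context: Model. $k$ anonymous identical stations share a channel. Time is divided into discrete synchronous rounds; there is no global clock available to the stations and no collision detection. Initially all stations are asleep. Each station holds one packet and is activated once, at a time chosen by an adversary. The activation round is round $0$ of the station's local clock, and the station may transmit from its local round $1$ on. In each round every active station either transmits or listens. A transmission is successful if and only if exactly one active station transmits in that round; the transmitter then receives an acknowledgement. In all other cases nothing is received. The algorithm is non-adaptive: transmission decisions depend only on the local round number (and private randomness), and a station switches off permanently right after its first successful transmission. An adaptive adversary decides online which station to activate and when, knowing the algorithm's code and the history of the computation but not future randomness; in total it activates $k$ stations. Protocol NonAdaptiveWithK$(k,c)$ (executed by each station from its activation, $\log$ is base $2$): for $0\le l\le \log\log k$ let $\varphi(l)=k/2^l$ if $l<\log\log k$ and $\varphi(l)=k$ if $l=\log\log k$. For $l=0,1,2,\ldots,\log\log k$: for $c\varphi(l)$ rounds, transmit in each round with probability $\frac{2^l}{2k}$, independently over rounds and stations. A station that has finished all iterations transmits no more. Quantities such as $\log\log k$ and $k/2^l$ are treated as integers (rounding is ignored). -}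

module Defs where

open import Data.Bool.Base using (Bool; true; false; if_then_else_; _∧_)
open import Data.Empty using (⊥)
open import Data.Fin.Base using (Fin)
open import Data.Fin.Subset using (Subset; _∈_; ∣_∣)
open import Data.Integer.Base using (+_)
open import Data.List.Base as List using (List; []; _∷_; [_]; length)
open import Data.List.Relation.Unary.Any using (Any)
open import Data.Nat.Base as ℕ using (ℕ; zero; suc; NonZero)
import Data.Nat.DivMod as ℕ
open import Data.Nat.ListAction using (sum)
open import Data.Nat.Logarithm using (⌈log₂_⌉)
import Data.Nat.Properties as ℕ
open import Data.Product.Base using (_×_; _,_; proj₁; proj₂; ∃; ∃-syntax)
open import Data.Rational.Base as ℚ using (ℚ; 0ℚ; 1ℚ; _/_)
open import Data.Rational.Properties using (+-*-rawSemiring)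
open import Data.Sum.Base using (_⊎_)
open import Data.Vec.Base as Vec using (Vec; []; _∷_)
open import Function.Bundles using (_⇔_)
open import Level using (0ℓ)
open import Relation.Nullary.Decidable using (Dec; does)
open import Relation.Unary using (Pred; Decidable)

open import Algebra.Definitions.RawSemiring +-*-rawSemiring public using ()
  renaming (_^_ to _^ℚ_)

------------------------------------------------------------------------
-- Real exponents

-- Two-sided Dedekind cuts: `lower p` is p < x and `upper p` is x < p.
record ℝ : Set₁ where
  field
    lower upper     : ℚ → Set
    lower-inhabited : ∃ lower
    upper-inhabited : ∃ upper
    lower-rounded   : ∀ p → lower p ⇔ (∃[ q ] p ℚ.< q × lower q)
    upper-rounded   : ∀ q → upper q ⇔ (∃[ p ] p ℚ.< q × upper p)
    disjoint        : ∀ p → lower p → upper p → ⊥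
    located         : ∀ p q → p ℚ.< q → lower p ⊎ upper q

open ℝ public

Positive : ℝ → Set
Positive x = lower x 0ℚ

-- x ≤ 1/k^η, for x ≥ 0, k ≥ 1 and η > 0.  By continuity this holds iff
-- x ≤ k^(-p/q) for all nonnegative rationals p/q < η, and the latter
-- inequality is x^q · k^p ≤ 1.
_≤1/_^_ : ℚ → ℕ → ℝ → Set
x ≤1/ k ^ η =
  ∀ p q .{{_ : NonZero q}} → lower η (+ p / q) →
  (x ^ℚ q) ℚ.* (+ (k ℕ.^ p) / 1) ℚ.≤ 1ℚ

-- t ≤ a · log₂ k, with the exact (unrounded) logarithm, for k ≥ 1.
_≤_·log₂_ : ℕ → ℕ → ℕ → Set
t ≤ a ·log₂ k = 2 ℕ.^ t ℕ.≤ k ℕ.^ a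

_≤?_·log₂_ : ∀ t a k → Dec (t ≤ a ·log₂ k)
t ≤? a ·log₂ k = 2 ℕ.^ t ℕ.≤? k ℕ.^ a

------------------------------------------------------------------------
-- Finite probability

-- Finitely supported distributions; an outcome may be listed repeatedly,
-- in which case its weights add up.
Dist : Set → Set
Dist A = List (A × ℚ)

Pr : ∀ {A : Set} {P : Pred A 0ℓ} → Dist A → Decidable P → ℚ
Pr d P? = List.foldr (λ (a , w) s → (if does (P? a) then w else 0ℚ) ℚ.+ s) 0ℚ d

bernoulli : ℚ → Dist Bool
bernoulli p = (true , p) ∷ (false , 1ℚ ℚ.- p) ∷ []

independent : ∀ {A : Set} {n} → Vec (Dist A) n → Dist (Vec A n)
independent []       = [ [] , 1ℚ ]
independent (d ∷ ds) =
  List.cartesianProductWith (λ (a , v) (as , w) → a ∷ as , v ℚ.* w) d (independent ds)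

------------------------------------------------------------------------
-- The protocol NonAdaptiveWithK(k,c)

-- Rounding convention: log log k and k/2^l are rounded up.
loglog : ℕ → ℕ
loglog k = ⌈log₂ ⌈log₂ k ⌉ ⌉

⌈_/2^_⌉ : ℕ → ℕ → ℕ
⌈ k /2^ l ⌉ = (k ℕ.+ (2 ℕ.^ l ℕ.∸ 1)) ℕ./ (2 ℕ.^ l)
  where instance _ = ℕ.m^n≢0 2 l

φ : ℕ → ℕ → ℕ
φ k l = if l ℕ.<ᵇ loglog k then ⌈ k /2^ l ⌉ else k

transmissionProbability : ∀ k .{{_ : NonZero k}} → ℕ → ℚ
transmissionProbability k l = + (2 ℕ.^ l) / (2 ℕ.* k)
  where instance _ = ℕ.m*n≢0 2 k

-- The transmission probabilities of local rounds 1, 2, 3, …  They lie in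
-- [0,1] for k ≥ 2, because 2 ^ loglog k ≤ 2k.
schedule : ∀ k .{{_ : NonZero k}} → ℕ → List ℚ
schedule k c =
  List.concatMap (λ l → List.replicate (c ℕ.* φ k l) (transmissionProbability k l))
                 (List.upTo (suc (loglog k)))

rounds : ∀ k .{{_ : NonZero k}} → ℕ → ℕ
rounds k c = length (schedule k c)

-- The private randomness of all k stations.  Entry j (from 0) of a
-- station's row says whether it wants to transmit in its local round 1 + j;
-- the entry is ignored if the station has switched off by then.
Coins : ℕ → ℕ → Set
Coins k R = Vec (Vec Bool R) k

coins : ∀ k .{{_ : NonZero k}} c → Dist (Coins k (rounds k c))
coins k c =
  independent (Vec.replicate k (independent (Vec.map bernoulli (Vec.fromList (schedule k c)))))

------------------------------------------------------------------------
-- The channel and the adversary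

-- The lists hold the transmission decisions for the local rounds to come.
data Station : Set where
  asleep : List Bool → Station
  active : List Bool → Station
  off    : Station

transmits : Station → Bool
transmits (active (b ∷ _)) = b
transmits _                = false

-- `woken`: the adversary picks this station in this round (no effect unless
-- it is asleep).  `lone`: exactly one station transmits in this round.
advance : (lone woken : Bool) → Station → Station
advance lone true  (asleep bs)       = active bs
advance lone false (asleep bs)       = asleep bs
advance lone _     (active [])       = active []
advance lone _     (active (b ∷ bs)) = if b ∧ lone then off else active bs
advance lone _     off               = off

record Round (k : ℕ) : Set where
  constructor round
  field
    activated   : Subset k
    transmitted : Subset k

open Round public

-- The most recent round comes first.
History : ℕ → Set
History k = List (Round k)

-- In each round the adversary chooses the stations to activate from the
-- history of all earlier rounds.
Strategy : ℕ → Set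
Strategy k = History k → Subset k

module _ {k R : ℕ} (strategy : Strategy k) (ω : Coins k R) where

  -- The stations and the history after the given number of global rounds.
  run : ℕ → Vec Station k × History k
  run zero    = Vec.map (λ bs → asleep (Vec.toList bs)) ω , []
  run (suc n) =
    let stations , past = run n
        chosen          = strategy past
        transmitting    = Vec.map transmits stations
        lone            = ∣ transmitting ∣ ℕ.≡ᵇ 1
    in Vec.zipWith (advance lone) chosen stations , round chosen transmitting ∷ past

  history : ℕ → History k
  history n = proj₂ (run n)

record Adversary (k R : ℕ) : Set where
  field
    strategy     : Strategy k
    activatesAll : ∀ (ω : Coins k R) →
      ∃[ n ] ∀ i → Any (λ r → i ∈ activated r) (history strategy ω n)

open Adversary public

-- The number of transmissions in the whole execution.  All stations are
-- activated within the first n rounds, so nobody transmits after the first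
-- n + R rounds, and the value does not depend on which such n is supplied.
attempts : ∀ {k R} → Adversary k R → Coins k R → ℕ
attempts {R = R} A ω =
  sum (List.map (λ r → ∣ transmitted r ∣) (history (strategy A) ω (n ℕ.+ R)))
  where n = proj₁ (activatesAll A ω)

-- Every attempt uses up one transmitting coin of one station, so the number of
-- attempts is at most the number X of true coins, whatever the adversary does.
-- The coins are independent, hence E[2^X] is the product of 1 + p over all
-- coins.  With u = 1/(2k), a coin of phase l contributes
-- 1 + 2^l u ≤ (1 + u)^(2^l), and (1 + u)^k ≤ 2; phase l has at most c k rounds,
-- so a station contributes at most 2^(c (1 + 2 + ⋯ + 2^loglog k)) ≤ k^(8c).
-- Thus E[2^X] ≤ k^(8ck), and Markov's inequality at 2^X ≥ k^((8c + N) k) with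
-- N ≥ η concludes.
module Submission where

open import Algebra.Bundles using (CommutativeRing)
import Algebra.Properties.CommutativeSemiring.Exp as Exp
open import Data.Bool.Base using (Bool; true; false; if_then_else_; _∧_)
open import Data.Fin.Subset using (∣_∣)
open import Data.Integer.Base as ℤ using (+_; -[1+_]; +≤+)
import Data.Integer.Properties as ℤ
open import Data.List.Base as List using (List; []; _∷_; _++_)
import Data.List.Properties as List
open import Data.List.Relation.Unary.All as All using (All; []; _∷_)
import Data.List.Relation.Unary.All.Properties as All
open import Data.Nat.Base as ℕ using (ℕ; zero; suc; _*_; _≤_; NonZero)
import Data.Nat.DivMod as ℕ
open import Data.Nat.ListAction using (sum)
open import Data.Nat.Logarithm using (⌈log₂_⌉; ⌈log₂⌉-mono-≤; ⌈log₂2^n⌉≡n)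
import Data.Nat.Properties as ℕ
import Data.Nat.Solver as NatSolver
open import Data.Product.Base using (_×_; _,_; proj₁; proj₂; ∃-syntax)
open import Data.Rational.Base as ℚ using (ℚ; mkℚ; 0ℚ; 1ℚ; _-_; _/_)
import Data.Rational.Properties as ℚ
open import Data.Rational.Solver using (module +-*-Solver)
import Data.Rational.Unnormalised.Base as ℚᵘ
import Data.Rational.Unnormalised.Properties as ℚᵘ
open import Data.Vec.Base as Vec using (Vec; []; _∷_)
open import Data.Vec.Relation.Unary.All as VecAll using ([]; _∷_)
import Data.Vec.Relation.Unary.All.Properties as VecAll
open import Function.Base using (const)
open import Function.Bundles using (Equivalence)
open import Level using (0ℓ)
open import Relation.Binary.PropositionalEquality
open import Relation.Nullary using (¬_; yes; no)
open import Relation.Unary using (Pred; Decidable)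

open import Defs

module ℕS = NatSolver.+-*-Solver

open Exp (CommutativeRing.commutativeSemiring ℚ.+-*-commutativeRing)
  using () renaming (^-assocʳ to ^ℚ-assocʳ; ^-distrib-* to ^ℚ-distrib-*)

-- Ordered field arithmetic

0≤1 : 0ℚ ℚ.≤ 1ℚ
0≤1 = ℚ.nonNegative⁻¹ 1ℚ

*-mono-≤ : ∀ {p q r s} → 0ℚ ℚ.≤ q → 0ℚ ℚ.≤ r → p ℚ.≤ q → r ℚ.≤ s → p ℚ.* r ℚ.≤ q ℚ.* s
*-mono-≤ {q = q} {r} 0≤q 0≤r p≤q r≤s = ℚ.≤-trans
  (ℚ.*-monoʳ-≤-nonNeg r {{ℚ.nonNegative 0≤r}} p≤q)
  (ℚ.*-monoˡ-≤-nonNeg q {{ℚ.nonNegative 0≤q}} r≤s)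

0≤* : ∀ {p q} → 0ℚ ℚ.≤ p → 0ℚ ℚ.≤ q → 0ℚ ℚ.≤ p ℚ.* q
0≤* {p} {q} 0≤p 0≤q = subst (ℚ._≤ p ℚ.* q) (ℚ.*-zeroˡ 0ℚ) (*-mono-≤ 0≤p ℚ.≤-refl 0≤p 0≤q)

0≤+ : ∀ {p q} → 0ℚ ℚ.≤ p → 0ℚ ℚ.≤ q → 0ℚ ℚ.≤ p ℚ.+ q
0≤+ 0≤p 0≤q = ℚ.+-mono-≤ 0≤p 0≤q

p≤p+q : ∀ {p q} → 0ℚ ℚ.≤ q → p ℚ.≤ p ℚ.+ q
p≤p+q {p} {q} 0≤q = subst (ℚ._≤ p ℚ.+ q) (ℚ.+-identityʳ p) (ℚ.+-monoʳ-≤ p 0≤q)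

p≤q⇒0≤q-p : ∀ {p q} → p ℚ.≤ q → 0ℚ ℚ.≤ q - p
p≤q⇒0≤q-p {p} {q} p≤q = subst (ℚ._≤ q - p) (ℚ.+-inverseʳ p) (ℚ.+-monoˡ-≤ (ℚ.- p) p≤q)

0≤^ : ∀ {p} n → 0ℚ ℚ.≤ p → 0ℚ ℚ.≤ p ^ℚ n
0≤^ zero    0≤p = 0≤1
0≤^ (suc n) 0≤p = 0≤* 0≤p (0≤^ n 0≤p)

^-monoˡ-≤ : ∀ {p q} n → 0ℚ ℚ.≤ p → p ℚ.≤ q → p ^ℚ n ℚ.≤ q ^ℚ n
^-monoˡ-≤ zero    0≤p p≤q = ℚ.≤-refl
^-monoˡ-≤ (suc n) 0≤p p≤q =
  *-mono-≤ (ℚ.≤-trans 0≤p p≤q) (0≤^ n 0≤p) p≤q (^-monoˡ-≤ n 0≤p p≤q)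

1≤^ : ∀ {p} n → 1ℚ ℚ.≤ p → 1ℚ ℚ.≤ p ^ℚ n
1≤^ zero        1≤p = ℚ.≤-refl
1≤^ {p} (suc n) 1≤p = *-mono-≤ (ℚ.≤-trans 0≤1 1≤p) 0≤1 1≤p (1≤^ n 1≤p)

^-monoʳ-≤ : ∀ {p m n} → 1ℚ ℚ.≤ p → m ≤ n → p ^ℚ m ℚ.≤ p ^ℚ n
^-monoʳ-≤ {n = n} 1≤p ℕ.z≤n   = 1≤^ n 1≤p
^-monoʳ-≤ {p} {m = suc m} 1≤p (ℕ.s≤s m≤n) =
  *-mono-≤ 0≤p (0≤^ m 0≤p) ℚ.≤-refl (^-monoʳ-≤ 1≤p m≤n)
  where 0≤p = ℚ.≤-trans 0≤1 1≤p

-- The embedding of ℕ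

ι : ℕ → ℚ
ι n = + n / 1

-- The operation `_/_` reduces to lowest terms and does not compute for open arguments. Identities
-- between such fractions are therefore checked on unnormalised fractions, where equality is cross
-- multiplication.
toℚᵘ-/ : ∀ m n .{{_ : NonZero n}} → ℚ.toℚᵘ (+ m / n) ℚᵘ.≃ (+ m ℚᵘ./ n)
toℚᵘ-/ m n@(suc _) = ℚ.toℚᵘ-fromℚᵘ (+ m ℚᵘ./ n)

ι-homo-+ : ∀ m n → ι (m ℕ.+ n) ≡ ι m ℚ.+ ι n
ι-homo-+ m n = ℚ.toℚᵘ-injective (begin
  ℚ.toℚᵘ (ι (m ℕ.+ n))                 ≈⟨ toℚᵘ-/ (m ℕ.+ n) 1 ⟩
  + (m ℕ.+ n) ℚᵘ./ 1
    ≈⟨ ℚᵘ.*≡* (cong (ℤ._* (+ 1)) (sym (cong₂ ℤ._+_ (ℤ.*-identityʳ (+ m)) (ℤ.*-identityʳ (+ n))))) ⟩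
  (+ m ℚᵘ./ 1) ℚᵘ.+ (+ n ℚᵘ./ 1)       ≈⟨ ℚᵘ.+-cong (toℚᵘ-/ m 1) (toℚᵘ-/ n 1) ⟨
  ℚ.toℚᵘ (ι m) ℚᵘ.+ ℚ.toℚᵘ (ι n)       ≈⟨ ℚ.toℚᵘ-homo-+ (ι m) (ι n) ⟨
  ℚ.toℚᵘ (ι m ℚ.+ ι n)                 ∎)
  where open ℚᵘ.≃-Reasoning

ι-homo-* : ∀ m n → ι (m * n) ≡ ι m ℚ.* ι n
ι-homo-* m n = ℚ.toℚᵘ-injective (begin
  ℚ.toℚᵘ (ι (m * n))                   ≈⟨ toℚᵘ-/ (m * n) 1 ⟩
  + (m * n) ℚᵘ./ 1                     ≈⟨ ℚᵘ.*≡* (cong (ℤ._* (+ 1)) (ℤ.pos-* m n)) ⟩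
  (+ m ℚᵘ./ 1) ℚᵘ.* (+ n ℚᵘ./ 1)       ≈⟨ ℚᵘ.*-cong (toℚᵘ-/ m 1) (toℚᵘ-/ n 1) ⟨
  ℚ.toℚᵘ (ι m) ℚᵘ.* ℚ.toℚᵘ (ι n)       ≈⟨ ℚ.toℚᵘ-homo-* (ι m) (ι n) ⟨
  ℚ.toℚᵘ (ι m ℚ.* ι n)                 ∎)
  where open ℚᵘ.≃-Reasoning

ι-homo-^ : ∀ m n → ι (m ℕ.^ n) ≡ ι m ^ℚ n
ι-homo-^ m zero    = refl
ι-homo-^ m (suc n) = trans (ι-homo-* m (m ℕ.^ n)) (cong (ι m ℚ.*_) (ι-homo-^ m n))

ι-mono-≤ : ∀ {m n} → m ≤ n → ι m ℚ.≤ ι n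
ι-mono-≤ {m} {n} m≤n = ℚ.toℚᵘ-cancel-≤ (begin
  ℚ.toℚᵘ (ι m)   ≃⟨ toℚᵘ-/ m 1 ⟩
  + m ℚᵘ./ 1     ≤⟨ ℚᵘ.*≤* (ℤ.*-monoʳ-≤-nonNeg (+ 1) (+≤+ m≤n)) ⟩
  + n ℚᵘ./ 1     ≃⟨ toℚᵘ-/ n 1 ⟨
  ℚ.toℚᵘ (ι n)   ∎)
  where open ℚᵘ.≤-Reasoning

ι-cancel-≤ : ∀ {m n} → ι m ℚ.≤ ι n → m ≤ n
ι-cancel-≤ {m} {n} m≤n = ℤ.drop‿+≤+ (ℤ.*-cancelʳ-≤-pos (+ m) (+ n) (+ 1) (ℚᵘ.drop-*≤* (begin
  + m ℚᵘ./ 1     ≃⟨ toℚᵘ-/ m 1 ⟨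
  ℚ.toℚᵘ (ι m)   ≤⟨ ℚ.toℚᵘ-mono-≤ m≤n ⟩
  ℚ.toℚᵘ (ι n)   ≃⟨ toℚᵘ-/ n 1 ⟩
  + n ℚᵘ./ 1     ∎)))
  where open ℚᵘ.≤-Reasoning

0≤ι : ∀ n → 0ℚ ℚ.≤ ι n
0≤ι n = ι-mono-≤ {0} {n} ℕ.z≤n

0≤/ : ∀ m n .{{_ : NonZero n}} → 0ℚ ℚ.≤ + m / n
0≤/ m n = ℚ.nonNegative⁻¹ _ {{ℚ.normalize-nonNeg m n}}

m/n≡m*1/n : ∀ m n .{{_ : NonZero n}} → + m / n ≡ ι m ℚ.* (+ 1 / n)
m/n≡m*1/n m n@(suc _) = ℚ.toℚᵘ-injective (begin
  ℚ.toℚᵘ (+ m / n)                        ≈⟨ toℚᵘ-/ m n ⟩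
  + m ℚᵘ./ n
    ≈⟨ ℚᵘ.*≡* (cong₂ ℤ._*_ (sym (ℤ.*-identityʳ (+ m))) (cong +_ (ℕ.*-identityˡ n))) ⟩
  (+ m ℚᵘ./ 1) ℚᵘ.* (+ 1 ℚᵘ./ n)          ≈⟨ ℚᵘ.*-cong (toℚᵘ-/ m 1) (toℚᵘ-/ 1 n) ⟨
  ℚ.toℚᵘ (ι m) ℚᵘ.* ℚ.toℚᵘ (+ 1 / n)      ≈⟨ ℚ.toℚᵘ-homo-* (ι m) (+ 1 / n) ⟨
  ℚ.toℚᵘ (ι m ℚ.* (+ 1 / n))              ∎)
  where open ℚᵘ.≃-Reasoning

n*1/n≡1 : ∀ n .{{_ : NonZero n}} → ι n ℚ.* (+ 1 / n) ≡ 1ℚ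
n*1/n≡1 n@(suc _) = trans (sym (m/n≡m*1/n n n)) (ℚ.toℚᵘ-injective (ℚᵘ.≃-trans (toℚᵘ-/ n n)
  (ℚᵘ.*≡* (ℤ.*-comm (+ n) (+ 1)))))

m≤n⇒m/n≤1 : ∀ {m n} .{{_ : NonZero n}} → m ≤ n → + m / n ℚ.≤ 1ℚ
m≤n⇒m/n≤1 {m} {n} m≤n = begin
  + m / n               ≡⟨ m/n≡m*1/n m n ⟩
  ι m ℚ.* (+ 1 / n)     ≤⟨ *-mono-≤ (0≤ι n) (0≤/ 1 n) (ι-mono-≤ m≤n) ℚ.≤-refl ⟩
  ι n ℚ.* (+ 1 / n)     ≡⟨ n*1/n≡1 n ⟩
  1ℚ                    ∎
  where open ℚ.≤-Reasoning

-- Clears the denominator by multiplying with `ι n`. It serves to compare exponents: a rational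
-- `p / q` below `N` yields `p ≤ N * q`.
m/n≤o⇒m≤o*n : ∀ {m n o} .{{_ : NonZero n}} → + m / n ℚ.≤ ι o → m ≤ o * n
m/n≤o⇒m≤o*n {m} {n} {o} m/n≤o = ι-cancel-≤ (begin
  ι m                              ≡⟨ ℚ.*-identityʳ (ι m) ⟨
  ι m ℚ.* 1ℚ
    ≡⟨ cong (ι m ℚ.*_) (trans (ℚ.*-comm (+ 1 / n) (ι n)) (n*1/n≡1 n)) ⟨
  ι m ℚ.* ((+ 1 / n) ℚ.* ι n)      ≡⟨ ℚ.*-assoc (ι m) (+ 1 / n) (ι n) ⟨
  ι m ℚ.* (+ 1 / n) ℚ.* ι n        ≡⟨ cong (ℚ._* ι n) (m/n≡m*1/n m n) ⟨
  (+ m / n) ℚ.* ι n                ≤⟨ *-mono-≤ (0≤ι o) (0≤ι n) m/n≤o ℚ.≤-refl ⟩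
  ι o ℚ.* ι n                      ≡⟨ ι-homo-* o n ⟨
  ι (o * n)                        ∎)
  where open ℚ.≤-Reasoning

-- A negative rational is below 0, and any other is at most its own numerator because the
-- denominator is at least 1.
ι-upperBound : ∀ r → ∃[ n ] r ℚ.≤ ι n
ι-upperBound r@(mkℚ -[1+ _ ] _ _) = 0 , ℚ.<⇒≤ (ℚ.negative⁻¹ r)
ι-upperBound r@(mkℚ (+ m) d _) = m , (begin
  r                   ≡⟨ ℚ.↥p/↧p≡p r ⟨
  + m / suc d         ≡⟨ m/n≡m*1/n m (suc d) ⟩
  ι m ℚ.* (+ 1 / suc d)
    ≤⟨ *-mono-≤ (0≤ι m) (0≤/ 1 (suc d)) ℚ.≤-refl (m≤n⇒m/n≤1 {1} {suc d} (ℕ.s≤s ℕ.z≤n)) ⟩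
  ι m ℚ.* 1ℚ          ≡⟨ ℚ.*-identityʳ (ι m) ⟩
  ι m                 ∎)
  where open ℚ.≤-Reasoning

-- Bernoulli's inequalities

1+nu≤[1+u]^n : ∀ {u} n → 0ℚ ℚ.≤ u → 1ℚ ℚ.+ ι n ℚ.* u ℚ.≤ (1ℚ ℚ.+ u) ^ℚ n
1+nu≤[1+u]^n {u} zero 0≤u = ℚ.≤-reflexive (cong (1ℚ ℚ.+_) (ℚ.*-zeroˡ u))
1+nu≤[1+u]^n {u} (suc n) 0≤u = begin
  1ℚ ℚ.+ ι (suc n) ℚ.* u
    ≡⟨ cong (λ x → 1ℚ ℚ.+ x ℚ.* u) (ι-homo-+ 1 n) ⟩
  1ℚ ℚ.+ (1ℚ ℚ.+ ι n) ℚ.* u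
    -- The added term n u² is exactly what completes the sum to the product (1 + u)(1 + n u).
    ≤⟨ p≤p+q (0≤* (0≤* 0≤u 0≤u) (0≤ι n)) ⟩
  1ℚ ℚ.+ (1ℚ ℚ.+ ι n) ℚ.* u ℚ.+ u ℚ.* u ℚ.* ι n
    ≡⟨ solve 2 (λ n u → con 1ℚ :+ (con 1ℚ :+ n) :* u :+ u :* u :* n
                     := (con 1ℚ :+ u) :* (con 1ℚ :+ n :* u)) refl (ι n) u ⟩
  (1ℚ ℚ.+ u) ℚ.* (1ℚ ℚ.+ ι n ℚ.* u)
    ≤⟨ *-mono-≤ 0≤1+u (0≤+ 0≤1 (0≤* (0≤ι n) 0≤u)) ℚ.≤-refl (1+nu≤[1+u]^n n 0≤u) ⟩
  (1ℚ ℚ.+ u) ℚ.* (1ℚ ℚ.+ u) ^ℚ n ∎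
  where
  open ℚ.≤-Reasoning
  open +-*-Solver
  0≤1+u = 0≤+ 0≤1 0≤u

-- In the induction the cross term u · 2nu is at most u by the smallness hypothesis, so each further
-- factor adds at most 2u. This replaces the exponential function in bounding (1 + 1/(2k))^k.
[1+u]^n≤1+2nu : ∀ {u} n → 0ℚ ℚ.≤ u → ι (2 * n) ℚ.* u ℚ.≤ 1ℚ →
                (1ℚ ℚ.+ u) ^ℚ n ℚ.≤ 1ℚ ℚ.+ ι (2 * n) ℚ.* u
[1+u]^n≤1+2nu {u} zero 0≤u _ = ℚ.≤-reflexive (sym (cong (1ℚ ℚ.+_) (ℚ.*-zeroˡ u)))
[1+u]^n≤1+2nu {u} (suc n) 0≤u 2[1+n]u≤1 = begin
  (1ℚ ℚ.+ u) ℚ.* (1ℚ ℚ.+ u) ^ℚ n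
    ≤⟨ *-mono-≤ 0≤1+u (0≤^ n 0≤1+u) ℚ.≤-refl ([1+u]^n≤1+2nu n 0≤u 2nu≤1) ⟩
  (1ℚ ℚ.+ u) ℚ.* (1ℚ ℚ.+ x ℚ.* u)
    ≡⟨ solve 2 (λ x u → (con 1ℚ :+ u) :* (con 1ℚ :+ x :* u)
                     := (con 1ℚ :+ u :+ x :* u) :+ u :* (x :* u)) refl x u ⟩
  (1ℚ ℚ.+ u ℚ.+ x ℚ.* u) ℚ.+ u ℚ.* (x ℚ.* u)
    ≤⟨ ℚ.+-monoʳ-≤ (1ℚ ℚ.+ u ℚ.+ x ℚ.* u) (*-mono-≤ 0≤u (0≤* (0≤ι (2 * n)) 0≤u) ℚ.≤-refl 2nu≤1) ⟩
  (1ℚ ℚ.+ u ℚ.+ x ℚ.* u) ℚ.+ u ℚ.* 1ℚ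
    ≡⟨ solve 2 (λ x u → (con 1ℚ :+ u :+ x :* u) :+ u :* con 1ℚ
                     := con 1ℚ :+ (con (ι 2) :+ x) :* u) refl x u ⟩
  1ℚ ℚ.+ (ι 2 ℚ.+ x) ℚ.* u
    ≡⟨ cong (λ y → 1ℚ ℚ.+ y ℚ.* u) (trans (cong ι (ℕ.*-suc 2 n)) (ι-homo-+ 2 (2 * n))) ⟨
  1ℚ ℚ.+ ι (2 * suc n) ℚ.* u ∎
  where
  open ℚ.≤-Reasoning
  open +-*-Solver
  x = ι (2 * n)
  0≤1+u = 0≤+ 0≤1 0≤u
  2nu≤1 : x ℚ.* u ℚ.≤ 1ℚ
  2nu≤1 = ℚ.≤-trans
    (*-mono-≤ (0≤ι (2 * suc n)) 0≤u (ι-mono-≤ (ℕ.*-monoʳ-≤ 2 (ℕ.n≤1+n n))) ℚ.≤-refl) 2[1+n]u≤1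

-- Expectations

E : ∀ {A : Set} → Dist A → (A → ℚ) → ℚ
E d f = List.foldr (λ (a , w) s → w ℚ.* f a ℚ.+ s) 0ℚ d

NonNegWeights : ∀ {A : Set} → Dist A → Set
NonNegWeights = All (λ (_ , w) → 0ℚ ℚ.≤ w)

mass : ∀ {A : Set} → Dist A → ℚ
mass d = E d (const 1ℚ)

IsProbability : ∀ {A : Set} → Dist A → Set
IsProbability d = NonNegWeights d × mass d ≡ 1ℚ

0≤E : ∀ {A : Set} {d : Dist A} {f} → NonNegWeights d → (∀ a → 0ℚ ℚ.≤ f a) → 0ℚ ℚ.≤ E d f
0≤E []         0≤f = ℚ.≤-refl
0≤E (0≤w ∷ ws) 0≤f = 0≤+ (0≤* 0≤w (0≤f _)) (0≤E ws 0≤f)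

-- Markov's inequality

module _ {A : Set} {P : Pred A 0ℓ} (P? : Decidable P) where

  Pr≤mass : ∀ {d} → NonNegWeights d → Pr d P? ℚ.≤ mass d
  Pr≤mass [] = ℚ.≤-refl
  Pr≤mass {(a , w) ∷ d} (0≤w ∷ ws) with P? a
  ... | yes _ = ℚ.+-mono-≤ (ℚ.≤-reflexive (sym (ℚ.*-identityʳ w))) (Pr≤mass ws)
  ... | no  _ = ℚ.+-mono-≤ (0≤* 0≤w 0≤1) (Pr≤mass ws)

  -- Each outcome of weight w is paid for separately: if `P` holds, the term of `Pr` contributes M
  -- w, and otherwise `f` is at least `M` there. The total mass stays a variable and nothing is
  -- subtracted, since the tail of a list is not a probability distribution and the induction has to
  -- pass through it.
  markov-mass : ∀ {d f M} → NonNegWeights d → (∀ a → 0ℚ ℚ.≤ f a) → (∀ a → ¬ P a → M ℚ.≤ f a) →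
                M ℚ.* mass d ℚ.≤ M ℚ.* Pr d P? ℚ.+ E d f
  markov-mass {M = M} [] 0≤f M≤f = ℚ.≤-reflexive (sym (ℚ.+-identityʳ (M ℚ.* 0ℚ)))
  markov-mass {(a , w) ∷ d} {f} {M} (0≤w ∷ ws) 0≤f M≤f with P? a
  ... | yes _ = begin
    M ℚ.* (w ℚ.* 1ℚ ℚ.+ mass d)
      ≡⟨ solve 3 (λ M w m → M :* (w :* con 1ℚ :+ m) := M :* w :+ M :* m) refl M w (mass d) ⟩
    M ℚ.* w ℚ.+ M ℚ.* mass d
      ≤⟨ ℚ.+-mono-≤ (p≤p+q {M ℚ.* w} (0≤* 0≤w (0≤f a))) (markov-mass ws 0≤f M≤f) ⟩
    (M ℚ.* w ℚ.+ w ℚ.* f a) ℚ.+ (M ℚ.* Pr d P? ℚ.+ E d f)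
      ≡⟨ solve 5 (λ M w y s e → (M :* w :+ w :* y) :+ (M :* s :+ e)
                             := M :* (w :+ s) :+ (w :* y :+ e)) refl M w (f a) (Pr d P?) (E d f) ⟩
    M ℚ.* (w ℚ.+ Pr d P?) ℚ.+ (w ℚ.* f a ℚ.+ E d f) ∎
    where
    open ℚ.≤-Reasoning
    open +-*-Solver
  ... | no ¬p = begin
    M ℚ.* (w ℚ.* 1ℚ ℚ.+ mass d)
      ≡⟨ solve 3 (λ M w m → M :* (w :* con 1ℚ :+ m) := w :* M :+ M :* m) refl M w (mass d) ⟩
    w ℚ.* M ℚ.+ M ℚ.* mass d
      ≤⟨ ℚ.+-mono-≤ (ℚ.*-monoˡ-≤-nonNeg w {{ℚ.nonNegative 0≤w}} (M≤f a ¬p)) (markov-mass ws 0≤f M≤f) ⟩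
    w ℚ.* f a ℚ.+ (M ℚ.* Pr d P? ℚ.+ E d f)
      ≡⟨ solve 5 (λ M w y s e → w :* y :+ (M :* s :+ e)
                             := M :* (con 0ℚ :+ s) :+ (w :* y :+ e)) refl M w (f a) (Pr d P?) (E d f) ⟩
    M ℚ.* (0ℚ ℚ.+ Pr d P?) ℚ.+ (w ℚ.* f a ℚ.+ E d f) ∎
    where
    open ℚ.≤-Reasoning
    open +-*-Solver

  markov : ∀ {d f M} → IsProbability d → (∀ a → 0ℚ ℚ.≤ f a) → (∀ a → ¬ P a → M ℚ.≤ f a) →
           (1ℚ - Pr d P?) ℚ.* M ℚ.≤ E d f
  markov {d} {f} {M} (ws , mass≡1) 0≤f M≤f = begin
    (1ℚ - Pr d P?) ℚ.* M
      ≡⟨ solve 2 (λ M s → (con 1ℚ :- s) :* M := M :* con 1ℚ :+ (:- (M :* s))) refl M (Pr d P?) ⟩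
    M ℚ.* 1ℚ - M ℚ.* Pr d P?
      ≡⟨ cong (λ m → M ℚ.* m - M ℚ.* Pr d P?) mass≡1 ⟨
    M ℚ.* mass d - M ℚ.* Pr d P?
      ≤⟨ ℚ.+-monoˡ-≤ (ℚ.- (M ℚ.* Pr d P?)) (markov-mass ws 0≤f M≤f) ⟩
    (M ℚ.* Pr d P? ℚ.+ E d f) - M ℚ.* Pr d P?
      ≡⟨ solve 2 (λ x e → (x :+ e) :- x := e) refl (M ℚ.* Pr d P?) (E d f) ⟩
    E d f ∎
    where
    open ℚ.≤-Reasoning
    open +-*-Solver

-- Expectations over independent products

E-++ : ∀ {A : Set} (d e : Dist A) f → E (d ++ e) f ≡ E d f ℚ.+ E e f
E-++ []            e f = sym (ℚ.+-identityˡ (E e f))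
E-++ ((a , w) ∷ d) e f =
  trans (cong (w ℚ.* f a ℚ.+_) (E-++ d e f)) (sym (ℚ.+-assoc (w ℚ.* f a) (E d f) (E e f)))

module _ {A : Set} {n} {f : Vec A (suc n) → ℚ} {g : A → ℚ} {h : Vec A n → ℚ}
         (f≡g*h : ∀ a as → f (a ∷ as) ≡ g a ℚ.* h as) where

  open ≡-Reasoning
  open +-*-Solver

  E-map-∷ : ∀ a v (es : Dist (Vec A n)) →
            E (List.map (λ (as , w) → a ∷ as , v ℚ.* w) es) f ≡ v ℚ.* g a ℚ.* E es h
  E-map-∷ a v [] = sym (ℚ.*-zeroʳ (v ℚ.* g a))
  E-map-∷ a v ((as , w) ∷ es) = begin
    v ℚ.* w ℚ.* f (a ∷ as) ℚ.+ E (List.map (λ (as , w) → a ∷ as , v ℚ.* w) es) f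
      ≡⟨ cong₂ (λ x y → v ℚ.* w ℚ.* x ℚ.+ y) (f≡g*h a as) (E-map-∷ a v es) ⟩
    v ℚ.* w ℚ.* (g a ℚ.* h as) ℚ.+ v ℚ.* g a ℚ.* E es h
      ≡⟨ solve 5 (λ v w x y e → v :* w :* (x :* y) :+ v :* x :* e
                             := v :* x :* (w :* y :+ e)) refl v w (g a) (h as) (E es h) ⟩
    v ℚ.* g a ℚ.* (w ℚ.* h as ℚ.+ E es h) ∎

  -- The product list is a concatenation of copies of `es`, one for each outcome of `d` and scaled
  -- by its weight. `E-map-∷` evaluates one copy, and distributivity collects them.
  E-independent-∷ : ∀ d (ds : Vec (Dist A) n) →
                    E (independent (d ∷ ds)) f ≡ E d g ℚ.* E (independent ds) h
  E-independent-∷ [] ds = sym (ℚ.*-zeroˡ (E (independent ds) h))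
  E-independent-∷ ((a , v) ∷ d) ds = begin
    E (List.map (λ (as , w) → a ∷ as , v ℚ.* w) es ++ independent (d ∷ ds)) f
      ≡⟨ E-++ (List.map (λ (as , w) → a ∷ as , v ℚ.* w) es) (independent (d ∷ ds)) f ⟩
    E (List.map (λ (as , w) → a ∷ as , v ℚ.* w) es) f ℚ.+ E (independent (d ∷ ds)) f
      ≡⟨ cong₂ ℚ._+_ (E-map-∷ a v es) (E-independent-∷ d ds) ⟩
    v ℚ.* g a ℚ.* E es h ℚ.+ E d g ℚ.* E es h
      ≡⟨ ℚ.*-distribʳ-+ (E es h) (v ℚ.* g a) (E d g) ⟨
    (v ℚ.* g a ℚ.+ E d g) ℚ.* E es h ∎
    where es = independent ds

nonNegWeights-independent-∷ : ∀ {A : Set} {n} {d} {ds : Vec (Dist A) n} → NonNegWeights d →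
  NonNegWeights (independent ds) → NonNegWeights (independent (d ∷ ds))
nonNegWeights-independent-∷ []                   ws = []
nonNegWeights-independent-∷ {ds = ds} (0≤v ∷ vs) ws =
  All.++⁺ (All.map⁺ (All.map (0≤* 0≤v) ws)) (nonNegWeights-independent-∷ {ds = ds} vs ws)

independent-isProbability : ∀ {A : Set} {n} {ds : Vec (Dist A) n} →
  VecAll.All IsProbability ds → IsProbability (independent ds)
independent-isProbability [] = 0≤1 ∷ [] , refl
independent-isProbability {ds = d ∷ ds} ((vs , d≡1) ∷ ps) with independent-isProbability ps
... | ws , ds≡1 = nonNegWeights-independent-∷ {d = d} {ds} vs ws ,
  -- The mass is the expectation of the constant 1, which factors as 1 · 1.
  trans (E-independent-∷ (λ _ _ → refl) d ds) (cong₂ ℚ._*_ d≡1 ds≡1)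

bernoulli-isProbability : ∀ {p} → 0ℚ ℚ.≤ p × p ℚ.≤ 1ℚ → IsProbability (bernoulli p)
bernoulli-isProbability {p} (0≤p , p≤1) = 0≤p ∷ p≤q⇒0≤q-p p≤1 ∷ [] ,
  solve 1 (λ p → p :* con 1ℚ :+ ((con 1ℚ :- p) :* con 1ℚ :+ con 0ℚ) := con 1ℚ) refl p
  where open +-*-Solver

-- The exponential moment of the number of transmitting coins

bit : Bool → ℕ
bit b = if b then 1 else 0

ones : List Bool → ℕ
ones []       = 0
ones (b ∷ bs) = bit b ℕ.+ ones bs

totalOnes : ∀ {k R} → Coins k R → ℕ
totalOnes []       = 0
totalOnes (bs ∷ ω) = ones (Vec.toList bs) ℕ.+ totalOnes ω

-- Converts an additive count of true coins into a product, the shape that `E-independent-∷` asks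
-- for.
2^-+ : ∀ m n → ι (2 ℕ.^ (m ℕ.+ n)) ≡ ι (2 ℕ.^ m) ℚ.* ι (2 ℕ.^ n)
2^-+ m n = trans (cong ι (ℕ.^-distribˡ-+-* 2 m n)) (ι-homo-* (2 ℕ.^ m) (2 ℕ.^ n))

-- For independent coins with success probabilities `ps` this is E[2^X], where X counts the true
-- coins: a single coin contributes 2p + (1 - p).
∏[1+_] : List ℚ → ℚ
∏[1+ ps ] = List.foldr (λ p x → (1ℚ ℚ.+ p) ℚ.* x) 1ℚ ps

E-2^bit : ∀ p → E (bernoulli p) (λ b → ι (2 ℕ.^ bit b)) ≡ 1ℚ ℚ.+ p
E-2^bit p =
  solve 1 (λ p → p :* con (ι 2) :+ ((con 1ℚ :- p) :* con 1ℚ :+ con 0ℚ) := con 1ℚ :+ p) refl p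
  where open +-*-Solver

E-2^ones : ∀ ps → E (independent (Vec.map bernoulli (Vec.fromList ps)))
                    (λ bs → ι (2 ℕ.^ ones (Vec.toList bs))) ≡ ∏[1+ ps ]
E-2^ones []       = refl
E-2^ones (p ∷ ps) = trans
  (E-independent-∷ {g = λ b → ι (2 ℕ.^ bit b)} (λ b bs → 2^-+ (bit b) (ones (Vec.toList bs))) (bernoulli p)
    (Vec.map bernoulli (Vec.fromList ps)))
  (cong₂ ℚ._*_ (E-2^bit p) (E-2^ones ps))

E-2^totalOnes : ∀ k {R} (d : Dist (Vec Bool R)) →
  E (independent (Vec.replicate k d)) (λ ω → ι (2 ℕ.^ totalOnes ω))
    ≡ E d (λ bs → ι (2 ℕ.^ ones (Vec.toList bs))) ^ℚ k
E-2^totalOnes zero    d = refl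
E-2^totalOnes (suc k) d = trans
  (E-independent-∷ (λ bs ω → 2^-+ (ones (Vec.toList bs)) (totalOnes ω)) d (Vec.replicate k d))
  (cong (E d (λ bs → ι (2 ℕ.^ ones (Vec.toList bs))) ℚ.*_) (E-2^totalOnes k d))

∏-++ : ∀ ps qs → ∏[1+ ps ++ qs ] ≡ ∏[1+ ps ] ℚ.* ∏[1+ qs ]
∏-++ []       qs = sym (ℚ.*-identityˡ ∏[1+ qs ])
∏-++ (p ∷ ps) qs = trans (cong ((1ℚ ℚ.+ p) ℚ.*_) (∏-++ ps qs))
                         (sym (ℚ.*-assoc (1ℚ ℚ.+ p) ∏[1+ ps ] ∏[1+ qs ]))

∏-replicate : ∀ n p → ∏[1+ List.replicate n p ] ≡ (1ℚ ℚ.+ p) ^ℚ n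
∏-replicate zero    p = refl
∏-replicate (suc n) p = cong ((1ℚ ℚ.+ p) ℚ.*_) (∏-replicate n p)

0≤∏ : ∀ {ps} → All (0ℚ ℚ.≤_) ps → 0ℚ ℚ.≤ ∏[1+ ps ]
0≤∏ []           = 0≤1
0≤∏ (0≤p ∷ 0≤ps) = 0≤* (0≤+ 0≤1 0≤p) (0≤∏ 0≤ps)

-- The schedule

-- When the rounded logarithm is `suc L`, the power `2 ^ L` cannot exceed `n`, since monotonicity
-- would then push the logarithm down to `L`. Doubling `2 ^ L ≤ n` gives the claim.
2^⌈log₂n⌉≤2n : ∀ n .{{_ : NonZero n}} → 2 ℕ.^ ⌈log₂ n ⌉ ≤ 2 * n
2^⌈log₂n⌉≤2n n with ⌈log₂ n ⌉ in eq
... | zero  = ℕ.>-nonZero⁻¹ (2 * n) {{ℕ.m*n≢0 2 n}}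
... | suc L = ℕ.*-monoʳ-≤ 2 (ℕ.≮⇒≥ λ n<2^L → ℕ.1+n≰n (begin
  suc L               ≡⟨ eq ⟨
  ⌈log₂ n ⌉           ≤⟨ ⌈log₂⌉-mono-≤ {n} {2 ℕ.^ L} (ℕ.<⇒≤ n<2^L) ⟩
  ⌈log₂ 2 ℕ.^ L ⌉     ≡⟨ ⌈log₂2^n⌉≡n L ⟩
  L                   ∎))
  where open ℕ.≤-Reasoning

n≤2^n : ∀ n → n ≤ 2 ℕ.^ n
n≤2^n zero    = ℕ.z≤n
n≤2^n (suc n) = begin
  1 ℕ.+ n                     ≤⟨ ℕ.+-mono-≤ (ℕ.m^n>0 2 n) (n≤2^n n) ⟩
  2 ℕ.^ n ℕ.+ 2 ℕ.^ n         ≡⟨ cong (2 ℕ.^ n ℕ.+_) (ℕ.+-identityʳ (2 ℕ.^ n)) ⟨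
  2 * 2 ℕ.^ n                 ∎
  where open ℕ.≤-Reasoning

-- A crude bound, enough to keep the transmission probabilities of all phases at most 1.
⌈log₂n⌉≤n : ∀ n → ⌈log₂ n ⌉ ≤ n
⌈log₂n⌉≤n n = subst (⌈log₂ n ⌉ ≤_) (⌈log₂2^n⌉≡n n) (⌈log₂⌉-mono-≤ (n≤2^n n))

2^loglog≤2log : ∀ {k} → 2 ≤ k → 2 ℕ.^ loglog k ≤ 2 * ⌈log₂ k ⌉
2^loglog≤2log {k} 2≤k =
  -- The bound is applied to the inner logarithm, which is at least 1 because `2 ≤ k`.
  2^⌈log₂n⌉≤2n ⌈log₂ k ⌉ {{ℕ.>-nonZero (subst (ℕ._≤ ⌈log₂ k ⌉) (⌈log₂2^n⌉≡n 1) (⌈log₂⌉-mono-≤ 2≤k))}}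

⌈n/2^l⌉≤n : ∀ n .{{_ : NonZero n}} l → ⌈ n /2^ l ⌉ ≤ n
-- The dividend n + (m - 1) is below (n + 1) m, so the quotient is below n + 1.
⌈n/2^l⌉≤n n l = ℕ.≤-pred (ℕ.m<n*o⇒m/o<n {n = suc n} {o = m} (begin-strict
  n ℕ.+ (m ℕ.∸ 1)     <⟨ ℕ.+-monoʳ-< n (ℕ.≤-reflexive (ℕ.suc-pred m)) ⟩
  n ℕ.+ m             ≤⟨ ℕ.+-monoˡ-≤ m (ℕ.m≤m*n n m) ⟩
  n * m ℕ.+ m         ≡⟨ ℕ.+-comm (n * m) m ⟩
  suc n * m           ∎))
  where
  open ℕ.≤-Reasoning
  m = 2 ℕ.^ l
  instance _ = ℕ.m^n≢0 2 l

-- Treating every phase as one of full length costs only a constant factor: the probabilities grow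
-- geometrically with `l`, so the last phase, which has full length anyway, dominates.
φ≤k : ∀ k .{{_ : NonZero k}} l → φ k l ≤ k
φ≤k k l with l ℕ.<ᵇ loglog k
... | true  = ⌈n/2^l⌉≤n k l
... | false = ℕ.≤-refl

-- The exponential moment under the schedule

module _ (k : ℕ) .{{_ : NonZero k}} where

  private
    instance
      2k≢0 : NonZero (2 * k)
      2k≢0 = ℕ.m*n≢0 2 k

    -- Every transmission probability is `2 ^ l` times `u`, so the factors of all phases can be
    -- compared with powers of the single base `b`.
    u b : ℚ
    u = + 1 / (2 * k)
    b = 1ℚ ℚ.+ u

    0≤u : 0ℚ ℚ.≤ u
    0≤u = 0≤/ 1 (2 * k)

    0≤b : 0ℚ ℚ.≤ b
    0≤b = 0≤+ 0≤1 0≤u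

    b^k≤2 : b ^ℚ k ℚ.≤ ι 2
    b^k≤2 = begin
      -- The smallness hypothesis holds with equality here, as 2k · u = 1.
      b ^ℚ k                      ≤⟨ [1+u]^n≤1+2nu k 0≤u (ℚ.≤-reflexive (n*1/n≡1 (2 * k))) ⟩
      1ℚ ℚ.+ ι (2 * k) ℚ.* u      ≡⟨ cong (1ℚ ℚ.+_) (n*1/n≡1 (2 * k)) ⟩
      1ℚ ℚ.+ 1ℚ                   ∎
      where open ℚ.≤-Reasoning

    0≤tp : ∀ l → 0ℚ ℚ.≤ transmissionProbability k l
    0≤tp l = 0≤/ (2 ℕ.^ l) (2 * k)

    1+tp≤b^2^l : ∀ l → 1ℚ ℚ.+ transmissionProbability k l ℚ.≤ b ^ℚ (2 ℕ.^ l)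
    1+tp≤b^2^l l = ℚ.≤-trans (ℚ.≤-reflexive (cong (1ℚ ℚ.+_) (m/n≡m*1/n (2 ℕ.^ l) (2 * k))))
                             (1+nu≤[1+u]^n (2 ℕ.^ l) 0≤u)

  module _ (c : ℕ) where

    phase : ℕ → List ℚ
    phase l = List.replicate (c * φ k l) (transmissionProbability k l)

    -- Truncations of the schedule, for induction on the number of phases; `schedule k c` is by
    -- definition `phases (suc (loglog k))`.
    phases : ℕ → List ℚ
    phases n = List.concatMap phase (List.upTo n)

    -- `upTo` unfolds at the front, whereas the induction in `∏-phases` splits off the last phase.
    phases-suc : ∀ n → phases (suc n) ≡ phases n ++ phase n
    phases-suc n = begin
      List.concatMap phase (List.upTo (suc n))
        ≡⟨ cong (List.concatMap phase) (List.upTo-∷ʳ n) ⟨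
      List.concatMap phase (List.upTo n ++ n ∷ [])
        ≡⟨ List.concatMap-++ phase (List.upTo n) (n ∷ []) ⟩
      phases n ++ (phase n ++ [])
        ≡⟨ cong (phases n ++_) (List.++-identityʳ (phase n)) ⟩
      phases n ++ phase n                               ∎
      where open ≡-Reasoning

    0≤phases : ∀ n → All (0ℚ ℚ.≤_) (phases n)
    0≤phases n = All.concat⁺ (All.map⁺
      (All.universal (λ l → All.replicate⁺ (c * φ k l) (0≤tp l)) (List.upTo n)))

    ∏-phase : ∀ l → ∏[1+ phase l ] ℚ.≤ ι (2 ℕ.^ (c * 2 ℕ.^ l))
    ∏-phase l = begin
      ∏[1+ phase l ]                      ≡⟨ ∏-replicate (c * φ k l) (transmissionProbability k l) ⟩
      (1ℚ ℚ.+ transmissionProbability k l) ^ℚ (c * φ k l)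
                                          ≤⟨ ^-monoˡ-≤ (c * φ k l) (0≤+ 0≤1 (0≤tp l)) (1+tp≤b^2^l l) ⟩
      (b ^ℚ (2 ℕ.^ l)) ^ℚ (c * φ k l)     ≡⟨ ^ℚ-assocʳ b (2 ℕ.^ l) (c * φ k l) ⟩
      -- Lengthening the phase to `c * k` rounds makes `k` a factor of the exponent, so that `b^k≤2`
      -- applies.
      b ^ℚ (2 ℕ.^ l * (c * φ k l))        ≤⟨ ^-monoʳ-≤ (p≤p+q 0≤u) exponent≤ ⟩
      b ^ℚ (k * (c * 2 ℕ.^ l))            ≡⟨ ^ℚ-assocʳ b k (c * 2 ℕ.^ l) ⟨
      (b ^ℚ k) ^ℚ (c * 2 ℕ.^ l)           ≤⟨ ^-monoˡ-≤ (c * 2 ℕ.^ l) (0≤^ k 0≤b) b^k≤2 ⟩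
      ι 2 ^ℚ (c * 2 ℕ.^ l)                ≡⟨ ι-homo-^ 2 (c * 2 ℕ.^ l) ⟨
      ι (2 ℕ.^ (c * 2 ℕ.^ l))             ∎
      where
      open ℚ.≤-Reasoning
      exponent≤ : 2 ℕ.^ l * (c * φ k l) ≤ k * (c * 2 ℕ.^ l)
      exponent≤ = ℕ.≤-trans
        (ℕ.*-monoʳ-≤ (2 ℕ.^ l) (ℕ.*-monoʳ-≤ c (φ≤k k l)))
        (ℕ.≤-reflexive (trans (ℕ.*-comm (2 ℕ.^ l) (c * k))
          (trans (cong (_* 2 ℕ.^ l) (ℕ.*-comm c k)) (ℕ.*-assoc k c (2 ℕ.^ l)))))

    -- The geometric sum of the exponents is rounded up to the next power of two. The earlier phases
    -- together then have the same bound as phase `n` alone, and one step of the induction doubles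
    -- the exponent.
    ∏-phases : ∀ n → ∏[1+ phases n ] ℚ.≤ ι (2 ℕ.^ (c * 2 ℕ.^ n))
    ∏-phases zero    = ι-mono-≤ {1} (ℕ.m^n>0 2 (c * 1))
    ∏-phases (suc n) = begin
      ∏[1+ phases (suc n) ]                 ≡⟨ cong ∏[1+_] (phases-suc n) ⟩
      ∏[1+ phases n ++ phase n ]            ≡⟨ ∏-++ (phases n) (phase n) ⟩
      ∏[1+ phases n ] ℚ.* ∏[1+ phase n ]
        ≤⟨ *-mono-≤ (0≤ι (2 ℕ.^ x)) (0≤∏ (All.replicate⁺ (c * φ k n) (0≤tp n))) (∏-phases n) (∏-phase n) ⟩
      ι (2 ℕ.^ x) ℚ.* ι (2 ℕ.^ x)           ≡⟨ 2^-+ x x ⟨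
      ι (2 ℕ.^ (x ℕ.+ x))
        ≡⟨ cong (λ y → ι (2 ℕ.^ y)) (ℕ.*-distribˡ-+ c (2 ℕ.^ n) (2 ℕ.^ n)) ⟨
      ι (2 ℕ.^ (c * (2 ℕ.^ n ℕ.+ 2 ℕ.^ n)))
        ≡⟨ cong (λ y → ι (2 ℕ.^ (c * (2 ℕ.^ n ℕ.+ y)))) (ℕ.+-identityʳ (2 ℕ.^ n)) ⟨
      ι (2 ℕ.^ (c * 2 ℕ.^ suc n))           ∎
      where
      open ℚ.≤-Reasoning
      x = c * 2 ℕ.^ n

    module _ (2≤k : 2 ≤ k) where

      schedule-isProbability : All (λ p → 0ℚ ℚ.≤ p × p ℚ.≤ 1ℚ) (schedule k c)
      schedule-isProbability = All.concat⁺ (All.map⁺ (All.map valid (All.all-upTo (suc (loglog k)))))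
        where
        open ℕ.≤-Reasoning
        valid : ∀ {l} → l ℕ.< suc (loglog k) → All (λ p → 0ℚ ℚ.≤ p × p ℚ.≤ 1ℚ) (phase l)
        valid {l} (ℕ.s≤s l≤loglog) = All.replicate⁺ (c * φ k l) (0≤tp l , m≤n⇒m/n≤1 (begin
          2 ℕ.^ l             ≤⟨ ℕ.^-monoʳ-≤ 2 l≤loglog ⟩
          2 ℕ.^ loglog k      ≤⟨ 2^loglog≤2log 2≤k ⟩
          2 * ⌈log₂ k ⌉       ≤⟨ ℕ.*-monoʳ-≤ 2 (⌈log₂n⌉≤n k) ⟩
          2 * k               ∎))

      coins-isProbability : IsProbability (coins k c)
      coins-isProbability = independent-isProbability (replicate⁺ k
        (independent-isProbability (VecAll.map⁺ (VecAll.map bernoulli-isProbability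
          (VecAll.fromList⁺ schedule-isProbability)))))
        where
        replicate⁺ : ∀ {A : Set} {P : A → Set} {x} n → P x → VecAll.All P (Vec.replicate n x)
        replicate⁺ zero    px = []
        replicate⁺ (suc n) px = px ∷ replicate⁺ n px

      -- The constant 8 is a product of three factors 2: one from the geometric sum over the phases,
      -- one from rounding up the outer logarithm in `loglog`, and one from `2 ^ L` ≤ 2k ≤ k², where
      -- `2 ≤ k` enters.
      2^[c*2^[1+loglog]]≤k^8c : 2 ℕ.^ (c * 2 ℕ.^ suc (loglog k)) ≤ k ℕ.^ (8 * c)
      2^[c*2^[1+loglog]]≤k^8c = begin
        2 ℕ.^ (c * (2 * 2 ℕ.^ loglog k))
          ≤⟨ ℕ.^-monoʳ-≤ 2 (ℕ.*-monoʳ-≤ c (ℕ.*-monoʳ-≤ 2 (2^loglog≤2log 2≤k))) ⟩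
        2 ℕ.^ (c * (2 * (2 * L)))
          ≡⟨ cong (2 ℕ.^_) (solve 2 (λ c L → c :* (con 2 :* (con 2 :* L)) := L :* (con 4 :* c)) refl c L) ⟩
        2 ℕ.^ (L * (4 * c))               ≡⟨ ℕ.^-*-assoc 2 L (4 * c) ⟨
        (2 ℕ.^ L) ℕ.^ (4 * c)             ≤⟨ ℕ.^-monoˡ-≤ (4 * c) (2^⌈log₂n⌉≤2n k) ⟩
        (2 * k) ℕ.^ (4 * c)
          ≤⟨ ℕ.^-monoˡ-≤ (4 * c) (ℕ.*-mono-≤ 2≤k (ℕ.≤-reflexive (sym (ℕ.*-identityʳ k)))) ⟩
        (k ℕ.^ 2) ℕ.^ (4 * c)             ≡⟨ ℕ.^-*-assoc k 2 (4 * c) ⟩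
        k ℕ.^ (2 * (4 * c))               ≡⟨ cong (k ℕ.^_) (ℕ.*-assoc 2 4 c) ⟨
        k ℕ.^ (8 * c)                     ∎
        where
        open ℕ.≤-Reasoning
        open ℕS
        L = ⌈log₂ k ⌉

      E-coins-2^totalOnes : E (coins k c) (λ ω → ι (2 ℕ.^ totalOnes ω)) ℚ.≤ ι (k ℕ.^ (8 * c * k))
      E-coins-2^totalOnes = begin
        E (coins k c) (λ ω → ι (2 ℕ.^ totalOnes ω))
          ≡⟨ E-2^totalOnes k (independent (Vec.map bernoulli (Vec.fromList (schedule k c)))) ⟩
        E (independent (Vec.map bernoulli (Vec.fromList (schedule k c))))
          (λ bs → ι (2 ℕ.^ ones (Vec.toList bs))) ^ℚ k
          ≡⟨ cong (_^ℚ k) (E-2^ones (schedule k c)) ⟩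
        ∏[1+ schedule k c ] ^ℚ k
          ≤⟨ ^-monoˡ-≤ k (0≤∏ (0≤phases (suc (loglog k))))
               (ℚ.≤-trans (∏-phases (suc (loglog k))) (ι-mono-≤ 2^[c*2^[1+loglog]]≤k^8c)) ⟩
        ι (k ℕ.^ (8 * c)) ^ℚ k
          ≡⟨ ι-homo-^ (k ℕ.^ (8 * c)) k ⟨
        ι ((k ℕ.^ (8 * c)) ℕ.^ k)
          ≡⟨ cong ι (ℕ.^-*-assoc k (8 * c) k) ⟩
        ι (k ℕ.^ (8 * c * k)) ∎
        where open ℚ.≤-Reasoning

-- Attempts along an execution

-- The potential of a station: the true coins that can still become attempts. Switching off forfeits
-- all of them.
remaining : Station → ℕ
remaining (asleep bs) = ones bs
remaining (active bs) = ones bs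
remaining off         = 0

totalRemaining : ∀ {k} → Vec Station k → ℕ
totalRemaining []       = 0
totalRemaining (s ∷ ss) = remaining s ℕ.+ totalRemaining ss

-- Both sides agree except after a success, where the coins left over are dropped.
transmit-remaining : ∀ lone b bs →
  bit b ℕ.+ remaining (if b ∧ lone then off else active bs) ≤ bit b ℕ.+ ones bs
transmit-remaining _     false bs = ℕ.≤-refl
transmit-remaining false true  bs = ℕ.≤-refl
transmit-remaining true  true  bs = ℕ.s≤s ℕ.z≤n

advance-remaining : ∀ lone woken s →
  bit (transmits s) ℕ.+ remaining (advance lone woken s) ≤ remaining s
advance-remaining _    true  (asleep bs)       = ℕ.≤-refl
advance-remaining _    false (asleep bs)       = ℕ.≤-refl
advance-remaining _    true  (active [])       = ℕ.≤-refl
advance-remaining _    false (active [])       = ℕ.≤-refl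
advance-remaining lone true  (active (b ∷ bs)) = transmit-remaining lone b bs
advance-remaining lone false (active (b ∷ bs)) = transmit-remaining lone b bs
advance-remaining _    true  off               = ℕ.≤-refl
advance-remaining _    false off               = ℕ.≤-refl

∣x∷p∣ : ∀ {n} x (p : Vec Bool n) → ∣ x ∷ p ∣ ≡ bit x ℕ.+ ∣ p ∣
∣x∷p∣ true  p = refl
∣x∷p∣ false p = refl

+-exchange : ∀ a b c d → (a ℕ.+ b) ℕ.+ (c ℕ.+ d) ≡ (a ℕ.+ c) ℕ.+ (b ℕ.+ d)
+-exchange = solve 4 (λ a b c d → (a :+ b) :+ (c :+ d) := (a :+ c) :+ (b :+ d)) refl
  where open ℕS

zipWith-advance-remaining : ∀ {k} lone (ws : Vec Bool k) ss →
  ∣ Vec.map transmits ss ∣ ℕ.+ totalRemaining (Vec.zipWith (advance lone) ws ss) ≤ totalRemaining ss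
zipWith-advance-remaining lone []       []       = ℕ.z≤n
zipWith-advance-remaining lone (w ∷ ws) (s ∷ ss) = begin
  ∣ transmits s ∷ ts ∣ ℕ.+ (r ℕ.+ rs)           ≡⟨ cong (ℕ._+ (r ℕ.+ rs)) (∣x∷p∣ (transmits s) ts) ⟩
  (bit (transmits s) ℕ.+ ∣ ts ∣) ℕ.+ (r ℕ.+ rs) ≡⟨ +-exchange (bit (transmits s)) ∣ ts ∣ r rs ⟩
  (bit (transmits s) ℕ.+ r) ℕ.+ (∣ ts ∣ ℕ.+ rs)
    ≤⟨ ℕ.+-mono-≤ (advance-remaining lone w s) (zipWith-advance-remaining lone ws ss) ⟩
  remaining s ℕ.+ totalRemaining ss             ∎
  where
  open ℕ.≤-Reasoning
  ts = Vec.map transmits ss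
  r  = remaining (advance lone w s)
  rs = totalRemaining (Vec.zipWith (advance lone) ws ss)

totalRemaining-asleep : ∀ {k R} (ω : Coins k R) →
  totalRemaining (Vec.map (λ bs → asleep (Vec.toList bs)) ω) ≡ totalOnes ω
totalRemaining-asleep []       = refl
totalRemaining-asleep (bs ∷ ω) = cong (ones (Vec.toList bs) ℕ.+_) (totalRemaining-asleep ω)

module _ {k R : ℕ} (strategy : Strategy k) (ω : Coins k R) where

  transmissions : ℕ → ℕ
  transmissions n = sum (List.map (λ r → ∣ transmitted r ∣) (history strategy ω n))

  -- In each round the potential falls by at least the number of transmitters, whichever set the
  -- adversary chooses, and at the start it equals the number of all true coins.
  transmissions+remaining≤totalOnes : ∀ n →
    transmissions n ℕ.+ totalRemaining (proj₁ (run strategy ω n)) ≤ totalOnes ω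
  transmissions+remaining≤totalOnes zero    = ℕ.≤-reflexive (totalRemaining-asleep ω)
  transmissions+remaining≤totalOnes (suc n) = begin
    (∣ ts ∣ ℕ.+ transmissions n) ℕ.+ rs   ≡⟨ cong (ℕ._+ rs) (ℕ.+-comm ∣ ts ∣ (transmissions n)) ⟩
    (transmissions n ℕ.+ ∣ ts ∣) ℕ.+ rs   ≡⟨ ℕ.+-assoc (transmissions n) ∣ ts ∣ rs ⟩
    transmissions n ℕ.+ (∣ ts ∣ ℕ.+ rs)
      ≤⟨ ℕ.+-monoʳ-≤ (transmissions n) (zipWith-advance-remaining (∣ ts ∣ ℕ.≡ᵇ 1) chosen stations) ⟩
    transmissions n ℕ.+ totalRemaining stations ≤⟨ transmissions+remaining≤totalOnes n ⟩
    totalOnes ω ∎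
    where
    open ℕ.≤-Reasoning
    stations = proj₁ (run strategy ω n)
    chosen   = strategy (history strategy ω n)
    ts       = Vec.map transmits stations
    rs       = totalRemaining (Vec.zipWith (advance (∣ ts ∣ ℕ.≡ᵇ 1)) chosen stations)

-- This domination holds outcome by outcome, so the adversary's dependence on the history never
-- enters the expectation.
attempts≤totalOnes : ∀ {k R} (A : Adversary k R) ω → attempts A ω ≤ totalOnes ω
attempts≤totalOnes {R = R} A ω = ℕ.m+n≤o⇒m≤o _
  (transmissions+remaining≤totalOnes (strategy A) ω (proj₁ (activatesAll A ω) ℕ.+ R))

-- Real exponents

-- If q < p, roundedness would carry the upper cut from q up to p, and p would lie in both cuts.
lower-≤ : ∀ x {p q} → lower x p → upper x q → p ℚ.≤ q
lower-≤ x {p} {q} p<x x<q = ℚ.≮⇒≥ λ q<p →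
  disjoint x p p<x (Equivalence.from (upper-rounded x p) (q , q<p , x<q))

-- A rational p/q below `η` is at most `N`, so p ≤ N q. Raising the exponent of `k` from p to N q
-- leaves the q-th power of `x` times `k ^ N`, which is at most 1.
x*k^N≤1⇒x≤1/k^η : ∀ η {x k} N .{{_ : NonZero k}} → 0ℚ ℚ.≤ x → (∀ {p} → lower η p → p ℚ.≤ ι N) →
  x ℚ.* ι (k ℕ.^ N) ℚ.≤ 1ℚ → x ≤1/ k ^ η
x*k^N≤1⇒x≤1/k^η η {x} {k} N 0≤x η≤N x*k^N≤1 p q p/q<η = begin
  (x ^ℚ q) ℚ.* ι (k ℕ.^ p)
    ≤⟨ *-mono-≤ (0≤^ q 0≤x) (0≤ι (k ℕ.^ p)) ℚ.≤-refl (ι-mono-≤ (ℕ.^-monoʳ-≤ k (m/n≤o⇒m≤o*n {p} {q} {N} (η≤N p/q<η)))) ⟩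
  (x ^ℚ q) ℚ.* ι (k ℕ.^ (N * q))
    ≡⟨ cong (λ y → (x ^ℚ q) ℚ.* ι y) (ℕ.^-*-assoc k N q) ⟨
  (x ^ℚ q) ℚ.* ι ((k ℕ.^ N) ℕ.^ q)
    ≡⟨ cong ((x ^ℚ q) ℚ.*_) (ι-homo-^ (k ℕ.^ N) q) ⟩
  (x ^ℚ q) ℚ.* (ι (k ℕ.^ N) ^ℚ q)
    ≡⟨ ^ℚ-distrib-* x (ι (k ℕ.^ N)) q ⟨
  (x ℚ.* ι (k ℕ.^ N)) ^ℚ q
    ≤⟨ ^-monoˡ-≤ q (0≤* 0≤x (0≤ι (k ℕ.^ N))) x*k^N≤1 ⟩
  1ℚ ^ℚ q
    ≡⟨ 1^n≡1 q ⟩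
  1ℚ ∎
  where
  open ℚ.≤-Reasoning
  1^n≡1 : ∀ n → 1ℚ ^ℚ n ≡ 1ℚ
  1^n≡1 zero    = refl
  1^n≡1 (suc n) = trans (ℚ.*-identityˡ (1ℚ ^ℚ n)) (1^n≡1 n)

-- The tail bound for the number of attempts

module _ (k : ℕ) .{{_ : NonZero k}} (2≤k : 2 ≤ k) (c N : ℕ) (A : Adversary k (rounds k c)) where

  private
    few? : Decidable (λ ω → attempts A ω ≤ ((N ℕ.+ 8 * c) * k) ·log₂ k)
    few? ω = attempts A ω ≤? ((N ℕ.+ 8 * c) * k) ·log₂ k

    δ : ℚ
    δ = 1ℚ - Pr (coins k c) few?

  0≤failure : 0ℚ ℚ.≤ δ
  0≤failure with coins-isProbability k c 2≤k
  ... | ws , mass≡1 = p≤q⇒0≤q-p (subst (Pr (coins k c) few? ℚ.≤_) mass≡1 (Pr≤mass few? ws))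

  -- The threshold in Markov's inequality splits as `k ^ (N * k)` times `K`, and `K` bounds the
  -- moment. Cancelling `K` leaves the factor `k ^ (N * k)`, which is at least `k ^ N`.
  failure*k^N≤1 : δ ℚ.* ι (k ℕ.^ N) ℚ.≤ 1ℚ
  failure*k^N≤1 = ℚ.≤-trans
    (*-mono-≤ 0≤failure (0≤ι (k ℕ.^ N)) ℚ.≤-refl (ι-mono-≤ (ℕ.^-monoʳ-≤ k (ℕ.m≤m*n N k))))
    (ℚ.*-cancelʳ-≤-pos (ι K) {{ℚ.positive 0<ιK}} (begin
      δ ℚ.* ι (k ℕ.^ (N * k)) ℚ.* ι K        ≡⟨ ℚ.*-assoc δ (ι (k ℕ.^ (N * k))) (ι K) ⟩
      δ ℚ.* (ι (k ℕ.^ (N * k)) ℚ.* ι K)      ≡⟨ cong (δ ℚ.*_) (ι-homo-* (k ℕ.^ (N * k)) K) ⟨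
      δ ℚ.* ι (k ℕ.^ (N * k) * K)
        ≡⟨ cong (λ x → δ ℚ.* ι x) (ℕ.^-distribˡ-+-* k (N * k) (8 * c * k)) ⟨
      δ ℚ.* ι (k ℕ.^ (N * k ℕ.+ 8 * c * k))
        ≡⟨ cong (λ x → δ ℚ.* ι (k ℕ.^ x)) (ℕ.*-distribʳ-+ k N (8 * c)) ⟨
      δ ℚ.* ι (k ℕ.^ ((N ℕ.+ 8 * c) * k))
        ≤⟨ markov few? (coins-isProbability k c 2≤k) (λ ω → 0≤ι (2 ℕ.^ totalOnes ω)) many⇒ ⟩
      E (coins k c) (λ ω → ι (2 ℕ.^ totalOnes ω)) ≤⟨ E-coins-2^totalOnes k c 2≤k ⟩
      ι K                                    ≡⟨ ℚ.*-identityˡ (ι K) ⟨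
      1ℚ ℚ.* ι K                             ∎))
    where
    open ℚ.≤-Reasoning
    K = k ℕ.^ (8 * c * k)
    0<ιK : 0ℚ ℚ.< ι K
    0<ιK = ℚ.<-≤-trans (ℚ.positive⁻¹ 1ℚ) (ι-mono-≤ {1} (ℕ.m^n>0 k (8 * c * k)))
    many⇒ : ∀ ω → ¬ (attempts A ω ≤ ((N ℕ.+ 8 * c) * k) ·log₂ k) →
            ι (k ℕ.^ ((N ℕ.+ 8 * c) * k)) ℚ.≤ ι (2 ℕ.^ totalOnes ω)
    -- The relation `_≤_·log₂_` compares `2 ^ t` with `k ^ a`, so its failure is already a lower
    -- bound on 2 to the number of attempts.
    many⇒ ω many = ι-mono-≤ (ℕ.≤-trans (ℕ.≰⇒≥ many) (ℕ.^-monoʳ-≤ 2 (attempts≤totalOnes A ω)))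

theorem3p2 : (η : ℝ) → Positive η →
    ∃[ c₀ ] ∀ (c : ℕ) → c₀ ≤ c →
    ∃[ C ] ∀ (k : ℕ) .{{_ : NonZero k}} → 2 ≤ k →
    (A : Adversary k (rounds k c)) →
    (1ℚ - Pr (coins k c) (λ ω → attempts A ω ≤? (C * k) ·log₂ k)) ≤1/ k ^ η
theorem3p2 η _ with upper-inhabited η
... | r , η<r with ι-upperBound r
-- `N` is a natural number above `η`, found through the rational `r` in the upper cut. The witness
-- for `C` is the exponent `N + 8 * c` of the tail bound, which holds for every `c`, whence the
-- threshold 0.
... | N , r≤N = 0 , λ c _ → N ℕ.+ 8 * c , λ k 2≤k A →
  x*k^N≤1⇒x≤1/k^η η N (0≤failure k 2≤k c N A) (λ p<η → ℚ.≤-trans (lower-≤ η p<η η<r) r≤N)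
    (failure*k^N≤1 k 2≤k c N A)
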